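{- Let $I$ and $C$ be disjoint finite sets of propositional variables and let $S$ be a set of explanations over hypotheses $I$ and manifestations $C$. There exists a propositional formula $F$ such that $\mathrm{abduct}(\langle F,I,C\rangle)=S$ if and only if $\mathrm{abduct}(\langle G(S),I,C\rangle)=S$, where $G(S)$ is the tentative-supporting formula of $S$.
   Context: Propositional formulae may contain arbitrary propositional variables. A set of variables is read as the set (conjunction) of the corresponding positive literals. An explanation over hypotheses $I$ and manifestations $C$ is a pair of sets $E\subseteq I$, $M\subseteq C$ with $M\neq\emptyset$, written $E\Rightarrow M$; $E\Rightarrow m$ abbreviates $E\Rightarrow\{m\}$. An abduction frame $\langle F,I,C\rangle$ ($F$ a propositional formula, $I\cap C=\emptyset$) supports $E\Rightarrow M$ if $F\cup E$ is consistent and entails every element of $M$. The set of explanations it supports is $\mathrm{abduct}(\langle F,I,C\rangle)$. A clause $E\rightarrow m$ (respectively $E\rightarrow\bot$) says that the conjunction of the variables in $E$ implies $m$ (respectively is contradictory); a set of clauses is read as their conjunction. The tentative-supporting formula $G(S)$ of a set $S$ of explanations over $I$ and $C$ is the set of the following clauses, where $E,E'\subseteq I$ and $m\in C$ is a single manifestation: (1) the clause $E\rightarrow m$ for each $E\Rightarrow m\in S$; (2) the clause $E\rightarrow\bot$ for each $E\Rightarrow m\notin S$ such that $E'\Rightarrow m\in S$ for some proper subset $E'\subset E$. -}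

module Defs where

open import Data.Bool.Base using (Bool; true; false; not) renaming (_∧_ to _and_; _∨_ to _or_)
open import Data.Bool.Properties using () renaming (_≟_ to _≟ᵇ_)
open import Data.Fin.Base using (Fin)
open import Data.Fin.Subset using (Subset; Nonempty; inside; outside; ⁅_⁆; _∈_; _⊂_)
open import Data.Fin.Subset.Properties using (_∈?_; _⊂?_; anySubset?; x∈⁅x⁆)
open import Data.List.Base using (List; []; _∷_; _++_; [_]; map; filter; foldr; lookup; length; allFin; cartesianProduct; cartesianProductWith)
open import Data.List.Relation.Binary.Disjoint.Propositional using (Disjoint)
open import Data.List.Relation.Unary.Unique.Propositional using (Unique)
import Data.List.Membership.DecPropositional as DecMembership
import Data.List.Membership.Propositional as Membership
open import Data.Nat.Base using (ℕ; zero; suc)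
open import Data.Product.Base using (∃-syntax; _×_; _,_)
open import Data.Vec.Base using ([]; _∷_)
open import Data.Vec.Properties using () renaming (≡-dec to ≡-decᵛ)
open import Level using (0ℓ)
open import Relation.Binary.Definitions using (DecidableEquality)
open import Relation.Binary.PropositionalEquality.Core using (_≡_; refl)
open import Relation.Nullary.Decidable.Core using (yes; no; _×-dec_; ¬?)
open import Relation.Nullary.Negation.Core using (¬_)
open import Relation.Unary using (Pred; Decidable)

infixr 7 _∧_
infixr 6 _∨_
infixr 5 _⊃_

data Formula (V : Set) : Set where
  var         : V → Formula V
  ⊤ ⊥         : Formula V
  ~_          : Formula V → Formula V
  _∧_ _∨_ _⊃_ : Formula V → Formula V → Formula V

Valuation : Set → Set
Valuation V = V → Bool

eval : {V : Set} → Valuation V → Formula V → Bool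
eval v (var x) = v x
eval v ⊤       = true
eval v ⊥       = false
eval v (~ A)   = not (eval v A)
eval v (A ∧ B) = eval v A and eval v B
eval v (A ∨ B) = eval v A or eval v B
eval v (A ⊃ B) = not (eval v A) or eval v B

Consistent : {V : Set} → Formula V → Set
Consistent A = ∃[ v ] eval v A ≡ true

infix 4 _⊨_

_⊨_ : {V : Set} → Formula V → Formula V → Set
A ⊨ B = ∀ v → eval v A ≡ true → eval v B ≡ true

⋀ : {V : Set} → List (Formula V) → Formula V
⋀ = foldr _∧_ ⊤

-- A finite set of variables is enumerated without repetition, so that its
-- subsets are exactly the stdlib subsets of its set of positions.
record VarSet (V : Set) : Set where
  constructor varSet
  field
    elements : List V
    unique   : Unique elements

  size : ℕ
  size = length elements

  at : Fin size → V
  at = lookup elements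

  SubsetOf : Set
  SubsetOf = Subset size

  -- A set of variables read as the conjunction of its positive literals.
  conj : SubsetOf → Formula V
  conj E = ⋀ (map (λ i → var (at i)) (filter (_∈? E) (allFin size)))

open VarSet public using (elements; size; at; SubsetOf; conj)

-- Non-emptiness is irrelevant, so an explanation is determined by the pair of
-- sets alone.
infix 4 _⇒_∣_

record Explanation {V : Set} (I C : VarSet V) : Set where
  constructor _⇒_∣_
  field
    hyps      : SubsetOf I
    manifs    : SubsetOf C
    .nonempty : Nonempty manifs

record Frame (V : Set) : Set where
  constructor ⟨_,_,_∣_⟩
  field
    formula        : Formula V
    hypotheses     : VarSet V
    manifestations : VarSet V
    disjoint       : Disjoint (elements hypotheses) (elements manifestations)

module _ {V : Set} (𝓕 : Frame V) where
  open Frame 𝓕 renaming (formula to F; hypotheses to I; manifestations to C)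

  abduct : Pred (Explanation I C) 0ℓ
  abduct (E ⇒ M ∣ _) =
    Consistent (F ∧ conj I E) × (∀ {m} → m ∈ M → (F ∧ conj I E) ⊨ var (at C m))

allSubsets : ∀ n → List (Subset n)
allSubsets zero    = [ [] ]
allSubsets (suc n) = cartesianProductWith _∷_ (outside ∷ inside ∷ []) (allSubsets n)

module _ {V : Set} {I C : VarSet V} where

  infix 4 _⇒₁_ _≟ᵉ_

  _⇒₁_ : SubsetOf I → Fin (size C) → Explanation I C
  E ⇒₁ m = E ⇒ ⁅ m ⁆ ∣ (m , x∈⁅x⁆ m)

  _≟ᵉ_ : DecidableEquality (Explanation I C)
  (E ⇒ M ∣ _) ≟ᵉ (E′ ⇒ M′ ∣ _) with ≡-decᵛ _≟ᵇ_ E E′ | ≡-decᵛ _≟ᵇ_ M M′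
  ... | yes refl | yes refl = yes refl
  ... | no E≢E′  | _        = no λ where refl → E≢E′ refl
  ... | yes _    | no M≢M′  = no λ where refl → M≢M′ refl

  open Membership using () renaming (_∈_ to _∈ˡ_)
  open DecMembership _≟ᵉ_ using () renaming (_∈?_ to _∈ˡ?_)

  module _ (S : List (Explanation I C)) where

    Supported : Pred (SubsetOf I × Fin (size C)) 0ℓ
    Supported (E , m) = (E ⇒₁ m) ∈ˡ S

    Refuted : Pred (SubsetOf I × Fin (size C)) 0ℓ
    Refuted (E , m) = ¬ ((E ⇒₁ m) ∈ˡ S) × ∃[ E′ ] (E′ ⊂ E × (E′ ⇒₁ m) ∈ˡ S)

    supported? : Decidable Supported
    supported? (E , m) = (E ⇒₁ m) ∈ˡ? S

    refuted? : Decidable Refuted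
    refuted? (E , m) =
      ¬? ((E ⇒₁ m) ∈ˡ? S) ×-dec anySubset? λ E′ → (E′ ⊂? E) ×-dec ((E′ ⇒₁ m) ∈ˡ? S)

    -- The tentative-supporting formula of S.
    G : Formula V
    G = ⋀ (map (λ (E , m) → conj I E ⊃ var (at C m)) (filter supported? pairs)
        ++ map (λ (E , m) → conj I E ⊃ ⊥) (filter refuted? pairs))
      where
      pairs : List (SubsetOf I × Fin (size C))
      pairs = cartesianProduct (allSubsets (size I)) (allFin (size C))

{-# OPTIONS --safe #-}
module Submission where

-- Only the implication from left to right needs an argument: conversely, G S
-- itself is the formula required.  So let F support exactly the explanations
-- in S.
--
-- F entails G S (tentative-entailed).  A clause E → m of the first kind holds
-- because F supports E ⇒ m.  For a clause E → ⊥ of the second kind, F entails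
-- m from some E′ ⊂ E, hence also from E; since F does not support E ⇒ m, the
-- set F ∪ E must be inconsistent.  It follows that every explanation supported
-- by F is supported by G S: consistency passes to the weaker formula, and the
-- entailments are clauses of the first kind.
--
-- Conversely, whatever S is, if G S ∪ E is consistent and entails m then
-- E ⇒ m ∈ S (entailed⇒supported).  Otherwise, take a model w of G S ∪ E and
-- make false in it m and all the hypotheses outside E.  The result satisfies E
-- and not m, so it must violate a clause of G S, and since w satisfies that
-- clause and no variable has become true, the clause is E″ → m with E″ ⊆ E and
-- E″ ⇒ m ∈ S.  As E ⇒ m ∉ S, E″ is a proper subset of E, so E → ⊥ is a clause
-- of G S, contradicting w.  Thus if G S supports E ⇒ M, then F supports E ⇒ m
-- for each m ∈ M, and as M is non-empty F supports E ⇒ M.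

open import Defs
open import Data.Bool.Base using (true; false)
open import Data.Fin.Base using (Fin; zero; suc)
open import Data.Fin.Properties using (any?) renaming (_≟_ to _≟ᶠ_)
open import Data.Fin.Subset using (Subset; inside; outside; _⊆_; _⊂_) renaming (_∈_ to _∈ˢ_; _∉_ to _∉ˢ_)
open import Data.Fin.Subset.Properties using (_∈?_; nonempty?; x∈⁅x⁆; x∈⁅y⁆⇒x≡y; ⊆-antisym)
open import Data.List.Base using (List; []; _∷_; filter; lookup; allFin; cartesianProduct)
open import Data.List.Membership.Propositional using (_∈_)
open import Data.List.Membership.Propositional.Properties using (∈-filter⁺; ∈-lookup; ∈-allFin; ∈-cartesianProduct⁺; ∈-cartesianProductWith⁺)
open import Data.List.Relation.Binary.Disjoint.Propositional using (Disjoint)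
open import Data.List.Relation.Unary.All as All using (All; []; _∷_)
open import Data.List.Relation.Unary.All.Properties using (all-filter; map⁺; map⁻; ++⁺; ++⁻)
open import Data.List.Relation.Unary.AllPairs using (_∷_)
open import Data.List.Relation.Unary.Any using (here; there)
open import Data.List.Relation.Unary.Unique.Propositional using (Unique)
open import Data.Product.Base using (∃-syntax; _×_; _,_; proj₁; proj₂)
open import Data.Sum.Base using (_⊎_; inj₁; inj₂)
open import Data.Vec.Base using ([]; _∷_)
open import Function.Bundles using (_⇔_; mk⇔; Equivalence)
open import Level using (0ℓ)
open import Relation.Binary.Definitions using (DecidableEquality)
open import Relation.Binary.PropositionalEquality.Core using (_≡_; _≢_; refl; sym; cong; subst)
open import Relation.Nullary.Decidable using (yes; no; ¬?; _×-dec_; _⊎-dec_; decidable-stable; recompute)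
open import Relation.Nullary.Negation.Core using (¬_; contradiction)
open import Relation.Unary using (Pred; Decidable; _≐_)

open Equivalence using (to; from)

-- Finite sets

lookup-injective : {A : Set} {xs : List A} → Unique xs →
  ∀ i j → lookup xs i ≡ lookup xs j → i ≡ j
lookup-injective (x∉xs ∷ u) zero    zero    eq = refl
lookup-injective (x∉xs ∷ u) zero    (suc j) eq = contradiction eq (All.lookup x∉xs (∈-lookup j))
lookup-injective (x∉xs ∷ u) (suc i) zero    eq = contradiction (sym eq) (All.lookup x∉xs (∈-lookup i))
lookup-injective (x∉xs ∷ u) (suc i) (suc j) eq = cong suc (lookup-injective u i j eq)

at-injective : {V : Set} (X : VarSet V) → ∀ {i j} → at X i ≡ at X j → i ≡ j
at-injective X = lookup-injective (VarSet.unique X) _ _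

at-disjoint : {V : Set} (X Y : VarSet V) → Disjoint (elements X) (elements Y) →
  ∀ i j → at X i ≢ at Y j
at-disjoint X Y X∩Y=∅ i j eq =
  X∩Y=∅ (∈-lookup i , subst (_∈ elements Y) (sym eq) (∈-lookup j))

∈-allSubsets : ∀ {n} (p : Subset n) → p ∈ allSubsets n
∈-allSubsets []      = here refl
∈-allSubsets (s ∷ p) = ∈-cartesianProductWith⁺ _∷_ (∈-sides s) (∈-allSubsets p)
  where
  ∈-sides : ∀ s → s ∈ (outside ∷ inside ∷ [])
  ∈-sides outside = here refl
  ∈-sides inside  = there (here refl)

⊆∧≢⇒⊂ : ∀ {n} {p q : Subset n} → p ⊆ q → p ≢ q → p ⊂ q
⊆∧≢⇒⊂ {p = p} {q} p⊆q p≢q with any? (λ x → (x ∈? q) ×-dec ¬? (x ∈? p))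
... | yes ∃x = p⊆q , ∃x
... | no ∄x  = contradiction (⊆-antisym p⊆q q⊆p) p≢q
  where
  q⊆p : q ⊆ p
  q⊆p {x} x∈q = decidable-stable (x ∈? p) λ x∉p → ∄x (x , x∈q , x∉p)

all-filter⇔ : {A : Set} {P Q : Pred A 0ℓ} (P? : Decidable P) (xs : List A) → (∀ x → x ∈ xs) →
  All Q (filter P? xs) ⇔ (∀ x → P x → Q x)
all-filter⇔ P? xs x∈xs = mk⇔
  (λ all x px → All.lookup all (∈-filter⁺ P? (x∈xs x) px))
  (λ P⊆Q → All.map (λ {x} → P⊆Q x) (all-filter P? xs))

-- Truth of formulae

module _ {V : Set} (v : Valuation V) where

  ∧-true⇔ : ∀ A B → eval v (A ∧ B) ≡ true ⇔ (eval v A ≡ true × eval v B ≡ true)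
  ∧-true⇔ A B with eval v A
  ... | true  = mk⇔ (refl ,_) proj₂
  ... | false = mk⇔ (λ ()) proj₁

  ⊃-true⇔ : ∀ A B → eval v (A ⊃ B) ≡ true ⇔ (eval v A ≡ true → eval v B ≡ true)
  ⊃-true⇔ A B with eval v A
  ... | true  = mk⇔ (λ b _ → b) (λ f → f refl)
  ... | false = mk⇔ (λ _ ()) (λ _ → refl)

  ⋀-true⇔ : ∀ As → eval v (⋀ As) ≡ true ⇔ All (λ A → eval v A ≡ true) As
  ⋀-true⇔ []       = mk⇔ (λ _ → []) (λ _ → refl)
  ⋀-true⇔ (A ∷ As) = mk⇔
    (λ t → let a , as = to (∧-true⇔ A (⋀ As)) t in a ∷ to (⋀-true⇔ As) as)
    (λ where (a ∷ as) → from (∧-true⇔ A (⋀ As)) (a , from (⋀-true⇔ As) as))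

  module _ (X : VarSet V) where

    conj-true⇔ : ∀ E → eval v (conj X E) ≡ true ⇔ (∀ i → i ∈ˢ E → v (at X i) ≡ true)
    conj-true⇔ E = mk⇔
      (λ t → to all⇔ (map⁻ (to (⋀-true⇔ _) t)))
      (λ f → from (⋀-true⇔ _) (map⁺ (from all⇔ f)))
      where
      all⇔ : All (λ i → v (at X i) ≡ true) (filter (_∈? E) (allFin (size X))) ⇔
             (∀ i → i ∈ˢ E → v (at X i) ≡ true)
      all⇔ = all-filter⇔ (_∈? E) (allFin (size X)) ∈-allFin

    conj-antitone : ∀ {E E′} → E′ ⊆ E → eval v (conj X E) ≡ true → eval v (conj X E′) ≡ true
    conj-antitone {E} {E′} E′⊆E t =
      from (conj-true⇔ E′) λ i i∈E′ → to (conj-true⇔ E) t i (E′⊆E i∈E′)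

-- The valuation that agrees with w except that the variables in P are false.
switchOff : {V : Set} {P : Pred V 0ℓ} → Decidable P → Valuation V → Valuation V
switchOff P? w x with P? x
... | yes _ = false
... | no  _ = w x

switchOff-true⇔ : {V : Set} {P : Pred V 0ℓ} (P? : Decidable P) (w : Valuation V) →
  ∀ x → switchOff P? w x ≡ true ⇔ (¬ P x × w x ≡ true)
switchOff-true⇔ P? w x with P? x
... | yes px = mk⇔ (λ ()) (λ (¬px , _) → contradiction px ¬px)
... | no ¬px = mk⇔ (¬px ,_) proj₂

-- The tentative-supporting formula

module _ {V : Set} {I C : VarSet V} (S : List (Explanation I C)) where

  -- Satisfaction of the two kinds of clauses of G S.
  Tentative : Valuation V → Set
  Tentative v =
    (∀ {E m} → Supported S (E , m) → eval v (conj I E) ≡ true → v (at C m) ≡ true) ×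
    (∀ {E m} → Refuted S (E , m) → ¬ (eval v (conj I E) ≡ true))

  G-true⇔ : ∀ v → eval v (G S) ≡ true ⇔ Tentative v
  G-true⇔ v = mk⇔
    (λ t → let sups , refs = ++⁻ _ (to (⋀-true⇔ v _) t) in
      (λ {E} {m} s → to (⊃-true⇔ v (conj I E) (var (at C m)))
        (to (all-filter⇔ (supported? S) pairs ∈-pairs) (map⁻ sups) (E , m) s)) ,
      (λ {E} {m} r t → contradiction
        (to (⊃-true⇔ v (conj I E) ⊥)
          (to (all-filter⇔ (refuted? S) pairs ∈-pairs) (map⁻ refs) (E , m) r) t)
        λ ()))
    (λ (sups , refs) → from (⋀-true⇔ v _) (++⁺
      (map⁺ (from (all-filter⇔ (supported? S) pairs ∈-pairs) λ (E , m) s →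
        from (⊃-true⇔ v (conj I E) (var (at C m))) (sups s)))
      (map⁺ (from (all-filter⇔ (refuted? S) pairs ∈-pairs) λ (E , m) r →
        from (⊃-true⇔ v (conj I E) ⊥) λ t → contradiction t (refs r)))))
    where
    pairs : List (SubsetOf I × Fin (size C))
    pairs = cartesianProduct (allSubsets (size I)) (allFin (size C))

    ∈-pairs : ∀ p → p ∈ pairs
    ∈-pairs (E , m) = ∈-cartesianProduct⁺ (∈-allSubsets E) (∈-allFin m)

  -- The only explanations with a single manifestation that G S supports are
  -- those in S.
  entailed⇒supported : DecidableEquality V → Disjoint (elements I) (elements C) →
    ∀ {E m} → Consistent (G S ∧ conj I E) → (G S ∧ conj I E) ⊨ var (at C m) → Supported S (E , m)
  entailed⇒supported _≟_ I∩C=∅ {E} {m} (w , w⊩G∧E) G∧E⊨m =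
    decidable-stable (supported? S (E , m)) λ Em∉S →
      proj₁ (to (off⇔ (at C m)) (G∧E⊨m v
        (from (∧-true⇔ v (G S) (conj I E)) (from (G-true⇔ v) (v-tentative Em∉S) , v⊩E))))
      (inj₁ refl)
    where
    w⊩G : Tentative w
    w⊩G = to (G-true⇔ w) (proj₁ (to (∧-true⇔ w (G S) (conj I E)) w⊩G∧E))

    w⊩E : eval w (conj I E) ≡ true
    w⊩E = proj₂ (to (∧-true⇔ w (G S) (conj I E)) w⊩G∧E)

    -- The variables to be made false in w: m and the hypotheses outside E.
    Off : Pred V 0ℓ
    Off x = x ≡ at C m ⊎ ∃[ i ] (i ∉ˢ E × at I i ≡ x)

    off? : Decidable Off
    off? x = (x ≟ at C m) ⊎-dec any? λ i → ¬? (i ∈? E) ×-dec (at I i ≟ x)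

    v : Valuation V
    v = switchOff off? w

    off⇔ : ∀ x → v x ≡ true ⇔ (¬ Off x × w x ≡ true)
    off⇔ = switchOff-true⇔ off? w

    v⊩E : eval v (conj I E) ≡ true
    v⊩E = from (conj-true⇔ v I E) λ i i∈E → from (off⇔ (at I i))
      ( (λ where
          (inj₁ i≡m)             → at-disjoint I C I∩C=∅ i m i≡m
          (inj₂ (j , j∉E , j≡i)) → j∉E (subst (_∈ˢ E) (sym (at-injective I j≡i)) i∈E))
      , to (conj-true⇔ w I E) w⊩E i i∈E)

    v≤w : ∀ E′ → eval v (conj I E′) ≡ true → eval w (conj I E′) ≡ true
    v≤w E′ t = from (conj-true⇔ w I E′) λ i i∈E′ →
      proj₂ (to (off⇔ (at I i)) (to (conj-true⇔ v I E′) t i i∈E′))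

    ⊩⇒⊆ : ∀ E′ → eval v (conj I E′) ≡ true → E′ ⊆ E
    ⊩⇒⊆ E′ t {i} i∈E′ = decidable-stable (i ∈? E) λ i∉E →
      proj₁ (to (off⇔ (at I i)) (to (conj-true⇔ v I E′) t i i∈E′)) (inj₂ (i , i∉E , refl))

    v-tentative : ¬ Supported S (E , m) → Tentative v
    v-tentative Em∉S = sups , λ {E′} r t → proj₂ w⊩G r (v≤w E′ t)
      where
      sups : ∀ {E′ m′} → Supported S (E′ , m′) → eval v (conj I E′) ≡ true → v (at C m′) ≡ true
      sups {E′} {m′} s t with m′ ≟ᶠ m
      ... | no m′≢m = from (off⇔ (at C m′))
        ( (λ where
            (inj₁ m′≡m)           → m′≢m (at-injective C m′≡m)
            (inj₂ (i , _ , i≡m′)) → at-disjoint I C I∩C=∅ i m′ i≡m′)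
        , proj₁ w⊩G s (v≤w E′ t))
      -- E′ is a proper subset of E, so E → ⊥ is a clause of G S, false in w.
      ... | yes refl = contradiction w⊩E
        (proj₂ w⊩G (Em∉S , E′ , ⊆∧≢⇒⊂ (⊩⇒⊆ E′ t) (λ where refl → Em∉S s) , s))

  -- The consequences of F supporting exactly the explanations in S.
  module _ (I∩C=∅ : Disjoint (elements I) (elements C)) (F : Formula V)
           (abduct≐S : abduct ⟨ F , I , C ∣ I∩C=∅ ⟩ ≐ (_∈ S)) where

    supported⇒entailed : ∀ {E m} → Supported S (E , m) → (F ∧ conj I E) ⊨ var (at C m)
    supported⇒entailed {m = m} s = proj₂ (proj₂ abduct≐S s) (x∈⁅x⁆ m)

    entailing⇒supported : ∀ {E m} → Consistent (F ∧ conj I E) →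
      (F ∧ conj I E) ⊨ var (at C m) → Supported S (E , m)
    entailing⇒supported {E} {m} con ent = proj₁ abduct≐S
      (con , λ m′∈ → subst (λ k → (F ∧ conj I E) ⊨ var (at C k)) (sym (x∈⁅y⁆⇒x≡y m m′∈)) ent)

    tentative-entailed : F ⊨ G S
    tentative-entailed v v⊩F = from (G-true⇔ v)
      ( (λ {E} s t → supported⇒entailed s v (from (∧-true⇔ v F (conj I E)) (v⊩F , t)))
      , (λ {E} (Em∉S , E′ , (E′⊆E , _) , s) t → Em∉S (entailing⇒supported
          (v , from (∧-true⇔ v F (conj I E)) (v⊩F , t))
          (λ u u⊩F∧E → let u⊩F , u⊩E = to (∧-true⇔ u F (conj I E)) u⊩F∧E in
            supported⇒entailed s u
              (from (∧-true⇔ u F (conj I E′)) (u⊩F , conj-antitone u I E′⊆E u⊩E))))))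

    G-supports : DecidableEquality V → abduct ⟨ G S , I , C ∣ I∩C=∅ ⟩ ≐ (_∈ S)
    G-supports _≟_ = sound , complete
      where
      sound : ∀ {e} → abduct ⟨ G S , I , C ∣ I∩C=∅ ⟩ e → e ∈ S
      sound {E ⇒ M ∣ M≠∅} (con , ent) =
        proj₁ abduct≐S (F-consistent , λ m∈M → supported⇒entailed (supported m∈M))
        where
        supported : ∀ {m} → m ∈ˢ M → Supported S (E , m)
        supported m∈M = entailed⇒supported _≟_ I∩C=∅ con (ent m∈M)

        F-consistent : Consistent (F ∧ conj I E)
        -- The proof that M is non-empty is irrelevant, so an element of M has to
        -- be found again by search.
        F-consistent = let m , m∈M = recompute (nonempty? M) M≠∅ in
          proj₁ (proj₂ abduct≐S (supported m∈M))

      complete : ∀ {e} → e ∈ S → abduct ⟨ G S , I , C ∣ I∩C=∅ ⟩ e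
      complete {E ⇒ M ∣ M≠∅} e∈S with proj₂ abduct≐S e∈S
      ... | con@(v , v⊩F∧E) , ent =
        let v⊩F , v⊩E = to (∧-true⇔ v F (conj I E)) v⊩F∧E in
        (v , from (∧-true⇔ v (G S) (conj I E)) (tentative-entailed v v⊩F , v⊩E)) ,
        λ m∈M u u⊩G∧E → let u⊩G , u⊩E = to (∧-true⇔ u (G S) (conj I E)) u⊩G∧E in
          proj₁ (to (G-true⇔ u) u⊩G) (entailing⇒supported con (ent m∈M)) u⊩E

theorem5 : {V : Set} → DecidableEquality V →
    (I C : VarSet V) (I∩C=∅ : Disjoint (elements I) (elements C)) →
    (S : List (Explanation I C)) →
    (∃[ F ] abduct ⟨ F , I , C ∣ I∩C=∅ ⟩ ≐ (_∈ S)) ⇔ (abduct ⟨ G S , I , C ∣ I∩C=∅ ⟩ ≐ (_∈ S))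
theorem5 _≟_ I C I∩C=∅ S = mk⇔ (λ (F , F≐S) → G-supports S I∩C=∅ F F≐S _≟_) (λ G≐S → G S , G≐S)
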